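{- Let $r,s,t$ be three integers with $r\leq 2(s-r)^3-\binom{s-r}{2}$ and $t\geq 47$, and let $k$ be a positive integer. Let $G_1$ be a graph of order $s$, and suppose there is an integer $a\geq 1$ and graphs $G_1,G_2,\ldots,G_a$ such that for each $2\leq i\leq a$ the graph $G_i$ is obtained from $G_{i-1}$ by deleting all leaves of $G_{i-1}$, and such that $G_a$ is a complete graph. If the total number of edges deleted in passing from $G_1$ to $G_a$ is $r$, then $$\operatorname{gr}_k(G_1,K_t)\leq 2^{kt}(s-r)^{3kt}.$$
   Context: The order of a graph is its number of vertices; a leaf is a vertex of degree one. A $k$-edge-coloring of $K_n$ assigns to each edge one of $k$ colors (not all colors need be used, and it need not be proper). A subgraph is rainbow if all its edges have distinct colors, and monochromatic if all its edges have the same color. For graphs $G,H$ and a positive integer $k$, the Gallai-Ramsey number $\operatorname{gr}_k(G,H)$ is the minimum integer $n$ such that every $k$-edge-coloring of the complete graph $K_n$ contains a rainbow copy of $G$ or a monochromatic copy of $H$. -}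

module Defs where

open import Level using (0ℓ)
open import Data.Fin using (Fin; _<?_)
open import Data.Fin.Properties using (_≟_)
open import Data.List using (List; length; filter; allFin; cartesianProduct)
open import Data.Nat using (ℕ; _≤_)
open import Data.Product using (∃; _×_; _,_)
open import Data.Sum using (_⊎_)
open import Function.Bundles using (_↣_; module Injection)
open import Relation.Binary using (Rel; Symmetric; Irreflexive; Decidable)
open import Relation.Binary.PropositionalEquality using (_≡_; _≢_; ≢-sym)
open import Relation.Nullary using (¬_; ¬?; _×-dec_)

-- Finite simple graphs.  Adjacency is decidable, so that degrees and edges
-- can be counted.  The graph with no vertices is allowed.
record Graph : Set₁ where
  infix 4 _~_ _~?_
  field
    order    : ℕ
    _~_      : Rel (Fin order) 0ℓ
    ~-sym    : Symmetric _~_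
    ~-irrefl : Irreflexive _≡_ _~_
    _~?_     : Decidable _~_

  Vertex : Set
  Vertex = Fin order

  degree : Vertex → ℕ
  degree v = length (filter (v ~?_) (allFin order))

  Leaf : Vertex → Set
  Leaf v = degree v ≡ 1

  -- Each edge is listed once, with its smaller endpoint first.
  edges : List (Vertex × Vertex)
  edges = filter (λ (u , v) → (u <? v) ×-dec (u ~? v))
                 (cartesianProduct (allFin order) (allFin order))

  size : ℕ
  size = length edges

  Complete : Set
  Complete = ∀ {u v} → u ≢ v → u ~ v

open Graph using (Vertex)

K : ℕ → Graph
K n = record
  { order    = n
  ; _~_      = _≢_
  ; ~-sym    = ≢-sym
  ; ~-irrefl = λ u≡v u≢v → u≢v u≡v
  ; _~?_     = λ u v → ¬? (u ≟ v)
  }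

-- H arises from G by simultaneously deleting all vertices that are leaves of
-- G: up to relabelling of vertices, H is the subgraph of G induced by the
-- non-leaves.
record LeafDeletion (G H : Graph) : Set where
  private
    module G = Graph G
    module H = Graph H
  field
    inclusion : H.Vertex ↣ G.Vertex

  ι : H.Vertex → G.Vertex
  ι = Injection.to inclusion

  field
    preserves : ∀ {u v} → u H.~ v → ι u G.~ ι v
    reflects  : ∀ {u v} → ι u G.~ ι v → u H.~ v
    avoids    : ∀ u → ¬ G.Leaf (ι u)
    exhausts  : ∀ w → ¬ G.Leaf w → ∃ λ u → ι u ≡ w

-- A colouring of the edges of K n.  The edge uv has the colour
-- colour u v = colour v u; the values colour u u carry no meaning and are
-- never inspected, as adjacency is irreflexive and copies are injective.
record EdgeColouring (k n : ℕ) : Set where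
  field
    colour     : Fin n → Fin n → Fin k
    colour-sym : ∀ u v → colour u v ≡ colour v u

-- Any injection of vertices embeds G as a (not necessarily induced) subgraph
-- of the complete graph.
Copy : Graph → ℕ → Set
Copy G n = Vertex G ↣ Fin n

module _ {k n : ℕ} (c : EdgeColouring k n) (G : Graph) (f : Copy G n) where
  open EdgeColouring c
  open Graph G using (_~_)
  open Injection f using (to)

  -- Edges of equal colour coincide as unordered pairs.
  Rainbow : Set
  Rainbow = ∀ {u v x y} → u ~ v → x ~ y →
            colour (to u) (to v) ≡ colour (to x) (to y) →
            (u ≡ x × v ≡ y) ⊎ (u ≡ y × v ≡ x)

  Monochromatic : Set
  Monochromatic = ∀ {u v x y} → u ~ v → x ~ y →
                  colour (to u) (to v) ≡ colour (to x) (to y)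

GallaiRamseyProperty : (k : ℕ) (G H : Graph) → ℕ → Set
GallaiRamseyProperty k G H n =
  (c : EdgeColouring k n) →
  (∃ λ (f : Copy G n) → Rainbow c G f) ⊎
  (∃ λ (f : Copy H n) → Monochromatic c H f)

-- n is the minimum defining gr_k(G,H); in particular that minimum exists.
IsGallaiRamseyNumber : (k : ℕ) (G H : Graph) → ℕ → Set
IsGallaiRamseyNumber k G H n =
  GallaiRamseyProperty k G H n ×
  (∀ m → GallaiRamseyProperty k G H m → n ≤ m)

{-# OPTIONS --safe #-}
module Submission where

-- Put p = s - r and M = 2 p³, so that the bound reads M^(kt).  Every Gᵢ has an
-- order in which, after at most p vertices, each vertex has at most one earlier
-- neighbour, and G₁ has at most C(p,2) + r ≤ M edges.
--
-- Start with M^(kt) vertices and repeatedly pick a vertex v and a colour i for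
-- which v has at least a 1/M fraction of the current set as i-neighbours; keep
-- only those.  If k(t-1) + 1 steps succeed, some colour occurs t times and gives a
-- monochromatic K_t.  For k ≤ M no step can fail.  For k > M, a failure leaves
-- a large set S in which all colour degrees are at most b, where M b ≤ |S|, and
-- G₁ is embedded in S greedily.  A pendant vertex must avoid fewer than M used
-- colours at its neighbour, and these exclude at most (M - 1) b vertices.
-- For the first p vertices one also needs that a new vertex w sees the chosen
-- v₁, ..., vⱼ in distinct colours.  For fixed vᵢ and w at most b vertices v have
-- c(vw) = c(vᵢw), so by averaging vⱼ₊₁ can be chosen with at most 2jb vertices w
-- that clash; in total p² b vertices are lost, which is less than M b.

open import Level using (0ℓ)
open import Data.Empty using (⊥-elim)
open import Data.Fin as Fin using (Fin; zero; suc)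
import Data.Fin.Properties as Finₚ
open import Data.List using (List; []; _∷_; [_]; _++_; map; length; filter; lookup; allFin; cartesianProduct)
open import Data.List.Properties using (length-map; length-++; length-tabulate; filter-all; filter-notAll)
open import Data.List.Membership.Propositional using (_∈_; _∉_; find; lose)
open import Data.List.Membership.Propositional.Properties
open import Data.List.Relation.Binary.Subset.Propositional using (_⊆_)
open import Data.List.Relation.Unary.All as All using (All; []; _∷_)
import Data.List.Relation.Unary.All.Properties as Allₚ
open import Data.List.Relation.Unary.AllPairs using (AllPairs; []; _∷_)
import Data.List.Relation.Unary.AllPairs.Properties as AllPairsₚ
open import Data.List.Relation.Unary.Any using (Any; here; there; any?; index)
open import Data.List.Relation.Unary.Any.Properties using (lookup-index)
open import Data.List.Relation.Unary.Unique.Propositional using (Unique)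
import Data.List.Relation.Unary.Unique.Propositional.Properties as Uniqueₚ
open import Data.Nat using (ℕ; zero; suc; _+_; _*_; _∸_; _^_; _≤_; _<_; z≤n; s≤s; _≤?_; _≤′_; ≤′-refl; ≤′-step; NonZero; >-nonZero)
open import Data.Nat.Combinatorics using (_C_; nCk+nC[k+1]≡[n+1]C[k+1]; nC1≡n)
open import Data.Nat.ListAction using (sum)
open import Data.Nat.Properties
open import Algebra.Properties.CommutativeSemigroup *-commutativeSemigroup using () renaming (interchange to *-interchange)
open import Algebra.Properties.CommutativeSemigroup +-commutativeSemigroup using (x∙yz≈y∙xz; xy∙z≈xz∙y; xy∙z≈zx∙y; x∙yz≈xz∙y)
open import Data.Nat.Tactic.RingSolver using (solve-∀)
open import Data.Product using (∃; ∃₂; _×_; _,_; proj₁; proj₂)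
open import Data.Sum using (_⊎_; inj₁; inj₂; [_,_]′; map₂)
open import Data.Vec.Functional using (updateAt)
open import Data.Vec.Functional.Properties using (updateAt-updates; updateAt-minimal)
open import Function using (_∘_; id; const)
open import Function.Bundles using (mk↣; module Injection)
open import Relation.Binary using (Rel; Symmetric; tri<; tri≈; tri>)
open import Relation.Binary.PropositionalEquality hiding ([_])
open import Relation.Nullary using (¬_; Dec; yes; no; ¬?; contradiction; _→-dec_; _×-dec_; _⊎-dec_; decidable-stable)
open import Relation.Unary using (Pred; Decidable)
open import Relation.Nullary.Decidable using (map′)
open import Defs

private
  variable
    A B : Set
    P Q R : Pred A 0ℓ

-- Counting in lists

lookup-allPairs : {R : Rel A 0ℓ} → Symmetric R → ∀ {xs} → AllPairs R xs →
                  ∀ {i j} → i ≢ j → R (lookup xs i) (lookup xs j)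
lookup-allPairs R-sym (r ∷ rs) {zero}  {zero}  i≢j = contradiction refl i≢j
lookup-allPairs R-sym (r ∷ rs) {zero}  {suc j} i≢j = All.lookup r (∈-lookup j)
lookup-allPairs R-sym (r ∷ rs) {suc i} {zero}  i≢j = R-sym (All.lookup r (∈-lookup i))
lookup-allPairs R-sym (r ∷ rs) {suc i} {suc j} i≢j = lookup-allPairs R-sym rs (i≢j ∘ cong suc)

-- Pigeonhole: equal positions in `ys` would repeat an entry of `xs`.
Unique-⊆⇒length-≤ : {xs ys : List A} → Unique xs → xs ⊆ ys → length xs ≤ length ys
Unique-⊆⇒length-≤ {xs = xs} {ys} xs! xs⊆ys = Finₚ.injective⇒≤ position-injective
  where
  position : Fin (length xs) → Fin (length ys)
  position i = index (xs⊆ys (∈-lookup i))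

  position-injective : ∀ {i j} → position i ≡ position j → i ≡ j
  position-injective {i} {j} eq = decidable-stable (i Finₚ.≟ j) λ i≢j →
    lookup-allPairs ≢-sym xs! i≢j
      (trans (lookup-index (xs⊆ys (∈-lookup i)))
        (trans (cong (lookup ys) eq) (sym (lookup-index (xs⊆ys (∈-lookup j))))))

length-cartesianProduct : ∀ (xs : List A) (ys : List B) →
                          length (cartesianProduct xs ys) ≡ length xs * length ys
length-cartesianProduct []       ys = refl
length-cartesianProduct (x ∷ xs) ys = trans (length-++ (map (x ,_) ys))
  (cong₂ _+_ (length-map (x ,_) ys) (length-cartesianProduct xs ys))

length-filter-mono : (P? : Decidable P) (Q? : Decidable Q) → (∀ {x} → P x → Q x) →
                     ∀ xs → length (filter P? xs) ≤ length (filter Q? xs)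
length-filter-mono P? Q? P⇒Q [] = z≤n
length-filter-mono P? Q? P⇒Q (x ∷ xs) with P? x | Q? x
... | yes p | yes q = s≤s (length-filter-mono P? Q? P⇒Q xs)
... | yes p | no ¬q = contradiction (P⇒Q p) ¬q
... | no ¬p | yes q = m≤n⇒m≤1+n (length-filter-mono P? Q? P⇒Q xs)
... | no ¬p | no ¬q = length-filter-mono P? Q? P⇒Q xs

length-filter-filter : (P? : Decidable P) (Q? : Decidable Q) →
                       ∀ xs → length (filter Q? (filter P? xs)) ≤ length (filter Q? xs)
length-filter-filter P? Q? [] = z≤n
length-filter-filter P? Q? (x ∷ xs) with P? x | Q? x in eq
... | yes p | yes q rewrite eq = s≤s (length-filter-filter P? Q? xs)
... | yes p | no ¬q rewrite eq = length-filter-filter P? Q? xs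
... | no ¬p | yes q = m≤n⇒m≤1+n (length-filter-filter P? Q? xs)
... | no ¬p | no ¬q = length-filter-filter P? Q? xs

length-filter-⊎ : (P? : Decidable P) (Q? : Decidable Q) (R? : Decidable R) →
                  (∀ {x} → P x → Q x ⊎ R x) →
                  ∀ xs → length (filter P? xs) ≤ length (filter Q? xs) + length (filter R? xs)
length-filter-⊎ P? Q? R? P⇒Q⊎R [] = z≤n
length-filter-⊎ P? Q? R? P⇒Q⊎R (x ∷ xs)
  with ih ← length-filter-⊎ P? Q? R? P⇒Q⊎R xs | P? x | Q? x | R? x
... | no ¬p | no ¬q | no ¬r = ih
... | no ¬p | yes q | no ¬r = m≤n⇒m≤1+n ih
... | no ¬p | no ¬q | yes r = ≤-trans ih (+-monoʳ-≤ _ (n≤1+n _))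
... | no ¬p | yes q | yes r = m≤n⇒m≤1+n (≤-trans ih (+-monoʳ-≤ _ (n≤1+n _)))
... | yes p | yes q | no ¬r = s≤s ih
... | yes p | yes q | yes r = s≤s (≤-trans ih (+-monoʳ-≤ _ (n≤1+n _)))
... | yes p | no ¬q | yes r = ≤-trans (s≤s ih) (≤-reflexive (sym (+-suc _ _)))
... | yes p | no ¬q | no ¬r = contradiction (P⇒Q⊎R p) [ ¬q , ¬r ]′

length-filter-∁ : (P? : Decidable P) → ∀ xs →
                  length (filter P? xs) + length (filter (¬? ∘ P?) xs) ≡ length xs
length-filter-∁ P? [] = refl
length-filter-∁ P? (x ∷ xs) with P? x
... | yes p = cong suc (length-filter-∁ P? xs)
... | no ¬p = trans (+-suc _ _) (cong suc (length-filter-∁ P? xs))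

-- Union bound: each `z` accounts for at most `d` entries of `xs`.
length-filter-any : {R : A → B → Set} (R? : ∀ z → Decidable (R z)) (d : ℕ) (zs : List A) (xs : List B) →
                    (∀ {z} → z ∈ zs → length (filter (R? z) xs) ≤ d) →
                    length (filter (λ x → any? (λ z → R? z x) zs) xs) ≤ length zs * d
length-filter-any R? d [] xs few =
  ≤-reflexive (cong length (filter-none-[] xs))
  where
  filter-none-[] : ∀ ys → filter (λ x → any? (λ z → R? z x) []) ys ≡ []
  filter-none-[] []       = refl
  filter-none-[] (y ∷ ys) = filter-none-[] ys
length-filter-any R? d (z ∷ zs) xs few = ≤-trans
  (length-filter-⊎ _ (R? z) (λ x → any? (λ z′ → R? z′ x) zs)
    (λ { (here r) → inj₁ r ; (there r) → inj₂ r }) xs)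
  (+-mono-≤ (few (here refl)) (length-filter-any R? d zs xs (few ∘ there)))

-- Turns a count of bad entries into the existence of a good one.
filter-escape : (P? : Decidable P) → ∀ xs → length (filter P? xs) < length xs →
                ∃ λ x → x ∈ xs × ¬ P x
filter-escape P? xs short with any? (¬? ∘ P?) xs
... | yes some = find some
... | no none = contradiction
  (cong length (filter-all P? (All.tabulate λ {x} x∈xs →
    decidable-stable (P? x) λ ¬p → none (lose x∈xs ¬p))))
  (<⇒≢ short)

module _ {R : A → B → Set} (R? : ∀ x → Decidable (R x)) where

  private
    incidences : List A → List B → ℕ
    incidences xs ys = sum (map (λ x → length (filter (R? x) ys)) xs)

    incidences-∷ : ∀ xs y ys → incidences xs (y ∷ ys) ≡
                   length (filter (λ x → R? x y) xs) + incidences xs ys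
    incidences-∷ [] y ys = refl
    incidences-∷ (x ∷ xs) y ys with R? x y
    ... | no  _ = trans (cong (length (filter (R? x) ys) +_) (incidences-∷ xs y ys))
                        (x∙yz≈y∙xz (length (filter (R? x) ys)) (length (filter (λ x′ → R? x′ y) xs)) (incidences xs ys))
    ... | yes _ = cong suc
                  (trans (cong (length (filter (R? x) ys) +_) (incidences-∷ xs y ys))
                        (x∙yz≈y∙xz (length (filter (R? x) ys)) (length (filter (λ x′ → R? x′ y) xs)) (incidences xs ys)))

    incidences-≥ : ∀ {c} xs ys → (∀ {x} → x ∈ xs → c ≤ length (filter (R? x) ys)) →
                   length xs * c ≤ incidences xs ys
    incidences-≥ []       ys many = z≤n
    incidences-≥ (x ∷ xs) ys many = +-mono-≤ (many (here refl)) (incidences-≥ xs ys (many ∘ there))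

    incidences-≤ : ∀ {d} xs ys → (∀ {y} → y ∈ ys → length (filter (λ x → R? x y) xs) ≤ d) →
                   incidences xs ys ≤ length ys * d
    incidences-≤ xs [] few = ≤-reflexive (incidences-[] xs)
      where
      incidences-[] : ∀ xs → incidences xs [] ≡ 0
      incidences-[] []       = refl
      incidences-[] (x ∷ xs) = incidences-[] xs
    incidences-≤ xs (y ∷ ys) few = ≤-trans (≤-reflexive (incidences-∷ xs y ys))
      (+-mono-≤ (few (here refl)) (incidences-≤ xs ys (few ∘ there)))

  -- Double counting of the related pairs: rows with more than `c` entries each would give at least
  -- `length xs * suc c` pairs, while the columns allow at most `length ys * d`.
  sparse-row : ∀ {c d} xs ys → (∀ {y} → y ∈ ys → length (filter (λ x → R? x y) xs) ≤ d) →
               length ys * d < length xs * suc c →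
               ∃ λ x → x ∈ xs × length (filter (R? x) ys) ≤ c
  sparse-row {c} xs ys few sparse with any? (λ x → length (filter (R? x) ys) ≤? c) xs
  ... | yes some = find some
  ... | no none = contradiction
    (≤-trans (incidences-≥ xs ys λ x∈xs → ≰⇒> (none ∘ lose x∈xs)) (incidences-≤ xs ys few))
    (<⇒≱ sparse)

-- Leaf deletion and peeling orders

-- The recursion mirrors Pascal's rule, which makes the length a binomial coefficient.
pairs : ∀ n → List (Fin n × Fin n)
pairs zero    = []
pairs (suc n) = map (λ v → zero , suc v) (allFin n) ++ map (λ (u , v) → suc u , suc v) (pairs n)

∈-pairs : ∀ {n} {u v : Fin n} → u Fin.< v → (u , v) ∈ pairs n
∈-pairs {u = zero}  {suc v} u<v = ∈-++⁺ˡ (∈-map⁺ _ (∈-allFin v))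
∈-pairs {u = suc u} {suc v} (s≤s u<v) = ∈-++⁺ʳ (map _ (allFin _)) (∈-map⁺ _ (∈-pairs u<v))

length-pairs : ∀ n → length (pairs n) ≡ n C 2
length-pairs zero    = refl
length-pairs (suc n) = begin
  length (pairs (suc n))                              ≡⟨ length-++ (map _ (allFin n)) ⟩
  length (map _ (allFin n)) + length (map _ (pairs n)) ≡⟨ cong₂ _+_ (length-map _ (allFin n)) (length-map _ (pairs n)) ⟩
  length (allFin n) + length (pairs n)                ≡⟨ cong₂ _+_ (length-tabulate {n = n} id) (length-pairs n) ⟩
  n + n C 2                                           ≡⟨ cong (_+ n C 2) (nC1≡n n) ⟨
  n C 1 + n C 2                                       ≡⟨ nCk+nC[k+1]≡[n+1]C[k+1] n 1 ⟩
  suc n C 2                                           ∎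
  where open ≡-Reasoning

nC2-mono : ∀ {m n} → m ≤ n → m C 2 ≤ n C 2
nC2-mono = go ∘ ≤⇒≤′
  where
  go : ∀ {m n} → m ≤′ n → m C 2 ≤ n C 2
  go ≤′-refl = ≤-refl
  go (≤′-step {n = n} m≤′n) = ≤-trans (go m≤′n)
    (≤-trans (m≤n+m _ _) (≤-reflexive (nCk+nC[k+1]≡[n+1]C[k+1] n 1)))

module _ (G : Graph) where
  open Graph G

  ∈-edges⁺ : ∀ {u v} → u Fin.< v → u ~ v → (u , v) ∈ edges
  ∈-edges⁺ u<v u~v = ∈-filter⁺ _ (∈-cartesianProduct⁺ (∈-allFin _) (∈-allFin _)) (u<v , u~v)

  ∈-edges⁻ : ∀ {u v} → (u , v) ∈ edges → u Fin.< v × u ~ v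
  ∈-edges⁻ uv∈ = proj₂ (∈-filter⁻ _ {xs = cartesianProduct (allFin order) (allFin order)} uv∈)

  edges-unique : Unique edges
  edges-unique = Uniqueₚ.filter⁺ _ (Uniqueₚ.cartesianProduct⁺ (Uniqueₚ.allFin⁺ order) (Uniqueₚ.allFin⁺ order))

  ∈-edges-⊎ : ∀ {u v} → u ~ v → (u , v) ∈ edges ⊎ (v , u) ∈ edges
  ∈-edges-⊎ {u} {v} u~v with Finₚ.<-cmp u v
  ... | tri< u<v _ _ = inj₁ (∈-edges⁺ u<v u~v)
  ... | tri≈ _ u≡v _ = contradiction u~v (~-irrefl u≡v)
  ... | tri> _ _ v<u = inj₂ (∈-edges⁺ v<u (~-sym u~v))

  size≤orderC2 : size ≤ order C 2
  size≤orderC2 = ≤-trans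
    (Unique-⊆⇒length-≤ edges-unique (∈-pairs ∘ proj₁ ∘ ∈-edges⁻))
    (≤-reflexive (length-pairs order))

  leaf? : Decidable Leaf
  leaf? v = degree v ≟ 1

  -- Meant for leaves, where it is the only neighbour; an isolated vertex gets itself as a dummy.
  neighbour : Vertex → Vertex
  neighbour w with filter (w ~?_) (allFin order)
  ... | []    = w
  ... | u ∷ _ = u

  leaf-neighbour : ∀ {w u} → Leaf w → w ~ u → neighbour w ≡ u
  leaf-neighbour {w} {u} leaf w~u
    with filter (w ~?_) (allFin order) | leaf | ∈-filter⁺ (w ~?_) (∈-allFin u) w~u
  ... | u′ ∷ [] | refl | here u≡u′ = sym u≡u′

-- Edges are listed with the smaller endpoint first, but an inclusion of graphs may reverse the
-- order of vertices, so images of edges have to be sorted.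
sort₂ : ∀ {n} → Fin n → Fin n → Fin n × Fin n
sort₂ u v with u Fin.<? v
... | yes _ = u , v
... | no  _ = v , u

sort₂-< : ∀ {n} {u v : Fin n} → u Fin.< v → sort₂ u v ≡ (u , v)
sort₂-< {u = u} {v} u<v with u Fin.<? v
... | yes _   = refl
... | no  u≮v = contradiction u<v u≮v

sort₂-> : ∀ {n} {u v : Fin n} → v Fin.< u → sort₂ u v ≡ (v , u)
sort₂-> {u = u} {v} v<u with u Fin.<? v
... | yes u<v = contradiction v<u (Finₚ.<-asym u<v)
... | no  _   = refl

module _ {G H : Graph} (del : LeafDeletion G H) where
  private
    module G = Graph G
    module H = Graph H
  open LeafDeletion del

  private
    leaves : List G.Vertex
    leaves = filter (leaf? G) (allFin G.order)

    ι-injective : ∀ {u v} → ι u ≡ ι v → u ≡ v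
    ι-injective = Injection.injective inclusion

  -- The images of vertices of `H` are no leaves, so together with the leaves they are distinct
  -- vertices of `G`.
  order-deletion : H.order + length leaves ≤ G.order
  order-deletion = begin
    H.order + length leaves                                ≡⟨ cong (_+ length leaves) (length-tabulate {n = H.order} id) ⟨
    length (allFin H.order) + length leaves                ≡⟨ cong (_+ length leaves) (length-map ι (allFin H.order)) ⟨
    length (map ι (allFin H.order)) + length leaves        ≡⟨ length-++ (map ι (allFin H.order)) ⟨
    length (map ι (allFin H.order) ++ leaves)              ≤⟨ Unique-⊆⇒length-≤ (Uniqueₚ.++⁺ (Uniqueₚ.map⁺ ι-injective (Uniqueₚ.allFin⁺ _)) (Uniqueₚ.filter⁺ _ (Uniqueₚ.allFin⁺ _)) disjoint) (λ _ → ∈-allFin _) ⟩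
    length (allFin G.order)                                ≡⟨ length-tabulate {n = G.order} id ⟩
    G.order                                                ∎
    where
    open ≤-Reasoning
    disjoint : ∀ {v} → ¬ (v ∈ map ι (allFin H.order) × v ∈ leaves)
    disjoint (v∈ι , v∈leaves) with u , _ , refl ← ∈-map⁻ ι v∈ι =
      avoids u (proj₂ (∈-filter⁻ (leaf? G) {xs = allFin G.order} v∈leaves))

  -- An edge with a leaf end is determined by that leaf, and an edge between two non-leaves comes
  -- from `H`. A component K₂ is counted once for each end, so equality can fail.
  size-deletion : G.size ≤ H.size + length leaves
  size-deletion = begin
    length G.edges                           ≤⟨ Unique-⊆⇒length-≤ (edges-unique G) covered ⟩
    length (map ι₂ H.edges ++ map toLeaf leaves) ≡⟨ length-++ (map ι₂ H.edges) ⟩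
    length (map ι₂ H.edges) + length (map toLeaf leaves) ≡⟨ cong₂ _+_ (length-map ι₂ H.edges) (length-map toLeaf leaves) ⟩
    H.size + length leaves                   ∎
    where
    open ≤-Reasoning
    ι₂ : H.Vertex × H.Vertex → G.Vertex × G.Vertex
    ι₂ (u , v) = sort₂ (ι u) (ι v)
    toLeaf : G.Vertex → G.Vertex × G.Vertex
    toLeaf w = sort₂ w (neighbour G w)
    covered : G.edges ⊆ map ι₂ H.edges ++ map toLeaf leaves
    covered {u , v} uv∈ with u<v , u~v ← ∈-edges⁻ G uv∈ with leaf? G u | leaf? G v
    ... | yes leaf | _ = ∈-++⁺ʳ (map ι₂ H.edges)
      (subst (_∈ map toLeaf leaves)
        (trans (cong (sort₂ u) (leaf-neighbour G leaf u~v)) (sort₂-< u<v))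
        (∈-map⁺ toLeaf (∈-filter⁺ (leaf? G) (∈-allFin u) leaf)))
    ... | no _ | yes leaf = ∈-++⁺ʳ (map ι₂ H.edges)
      (subst (_∈ map toLeaf leaves)
        (trans (cong (sort₂ v) (leaf-neighbour G leaf (G.~-sym u~v))) (sort₂-> u<v))
        (∈-map⁺ toLeaf (∈-filter⁺ (leaf? G) (∈-allFin v) leaf)))
    ... | no ¬leaf-u | no ¬leaf-v
      with u′ , refl ← exhausts u ¬leaf-u | v′ , refl ← exhausts v ¬leaf-v
      with ∈-edges-⊎ H (reflects u~v)
    ...   | inj₁ e = ∈-++⁺ˡ (subst (_∈ map ι₂ H.edges) (sort₂-< u<v) (∈-map⁺ ι₂ e))
    ...   | inj₂ e = ∈-++⁺ˡ (subst (_∈ map ι₂ H.edges) (sort₂-> u<v) (∈-map⁺ ι₂ e))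

-- The list enumerates vertices in reverse order of embedding: at most q arbitrary
-- vertices first, then vertices with at most one neighbour among the earlier ones.
-- A component K₂ of some Gᵢ vanishes altogether; one of its ends then has no
-- earlier neighbour at all.
data Peeling (G : Graph) (q : ℕ) : List (Graph.Vertex G) → Set where
  core    : ∀ {xs} → Unique xs → length xs ≤ q → Peeling G q xs
  pendant : ∀ {x xs} → let open Graph G in
            x ∉ xs → (∀ {u v} → u ∈ xs → v ∈ xs → x ~ u → x ~ v → u ≡ v) →
            Peeling G q xs → Peeling G q (x ∷ xs)

Peeling-unique : ∀ {G q xs} → Peeling G q xs → Unique xs
Peeling-unique (core xs! _)          = xs!
Peeling-unique (pendant x∉xs _ peel) =
  All.tabulate (λ {y} y∈xs x≡y → x∉xs (subst (_∈ _) (sym x≡y) y∈xs)) ∷ Peeling-unique peel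

module _ {G : Graph} {q : ℕ} where
  open Graph G
  open import Data.List.Membership.DecPropositional (Finₚ._≟_ {order}) using (_∈?_)

  -- A vertex of `ws` not yet listed must be a leaf. It has only one neighbour in the whole graph,
  -- so it can be put in front as a pendant vertex.
  Peeling-add-leaves : ∀ ws {xs} → (∀ {w} → w ∈ ws → w ∈ xs ⊎ Leaf w) → Peeling G q xs →
                       ∃ λ ys → Peeling G q ys × xs ⊆ ys × ws ⊆ ys
  Peeling-add-leaves []       {xs} covered peel = xs , peel , id , λ ()
  Peeling-add-leaves (w ∷ ws) {xs} covered peel
    with ys , peel′ , xs⊆ys , ws⊆ys ← Peeling-add-leaves ws (covered ∘ there) peel
    with w ∈? ys
  ... | yes w∈ys = ys , peel′ , xs⊆ys , λ { (here refl) → w∈ys ; (there w′∈) → ws⊆ys w′∈ }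
  ... | no  w∉ys = w ∷ ys , pendant w∉ys one-neighbour peel′ , there ∘ xs⊆ys ,
                   λ { (here refl) → here refl ; (there w′∈) → there (ws⊆ys w′∈) }
    where
    leaf : Leaf w
    leaf = [ (λ w∈xs → contradiction (xs⊆ys w∈xs) w∉ys) , id ]′ (covered (here refl))
    one-neighbour : ∀ {u v} → u ∈ ys → v ∈ ys → w ~ u → w ~ v → u ≡ v
    one-neighbour _ _ w~u w~v = trans (sym (leaf-neighbour G leaf w~u)) (leaf-neighbour G leaf w~v)

module _ {G H : Graph} (del : LeafDeletion G H) where
  private
    module G = Graph G
    module H = Graph H
  open LeafDeletion del

  Peeling-map : ∀ {q xs} → Peeling H q xs → Peeling G q (map ι xs)
  Peeling-map (core {xs} xs! short) =
    core (Uniqueₚ.map⁺ (Injection.injective inclusion) xs!) (≤-trans (≤-reflexive (length-map ι xs)) short)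
  Peeling-map {q} (pendant {x} {xs} x∉xs one-neighbour peel) = pendant ιx∉ one-neighbour′ (Peeling-map peel)
    where
    ιx∉ : ι x ∉ map ι xs
    ιx∉ ιx∈ with y , y∈xs , ιx≡ιy ← ∈-map⁻ ι ιx∈ =
      x∉xs (subst (_∈ xs) (sym (Injection.injective inclusion ιx≡ιy)) y∈xs)
    one-neighbour′ : ∀ {u v} → u ∈ map ι xs → v ∈ map ι xs → ι x G.~ u → ι x G.~ v → u ≡ v
    one-neighbour′ u∈ v∈ x~u x~v
      with u′ , u′∈ , refl ← ∈-map⁻ ι u∈ | v′ , v′∈ , refl ← ∈-map⁻ ι v∈ =
      cong ι (one-neighbour u′∈ v′∈ (reflects x~u) (reflects x~v))

  -- The leaves of `G` are embedded after everything that comes from `H`.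
  Peeling-deletion : ∀ {q xs} → Peeling H q xs → (∀ v → v ∈ xs) →
                     ∃ λ ys → Peeling G q ys × (∀ v → v ∈ ys)
  Peeling-deletion {xs = xs} peel all∈xs =
    let ys , peel′ , _ , all⊆ys = Peeling-add-leaves (allFin G.order) covered (Peeling-map peel)
    in  ys , peel′ , λ v → all⊆ys (∈-allFin v)
    where
    covered : ∀ {w} → w ∈ allFin G.order → w ∈ map ι xs ⊎ G.Leaf w
    covered {w} _ with leaf? G w
    ... | yes leaf = inj₂ leaf
    ... | no ¬leaf with u , refl ← exhausts w ¬leaf = inj₁ (∈-map⁺ ι (all∈xs u))

-- Here q and e are the order and the size of the final graph; sparse says that no
-- more edges than vertices were deleted.
record Peelable (q e : ℕ) (G : Graph) : Set where
  open Graph G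
  field
    core≤order : q ≤ order
    sparse     : size + q ≤ e + order
    {ordering} : List Vertex
    peeling    : Peeling G q ordering
    exhaustive : ∀ v → v ∈ ordering

-- Deleting ℓ leaves removes at most ℓ edges and at least ℓ vertices, which preserves `sparse`.
Peelable-deletion : ∀ {q e G H} → LeafDeletion G H → Peelable q e H → Peelable q e G
Peelable-deletion {q} {e} {G} {H} del peelable = record
  { core≤order = ≤-trans core≤order (≤-trans (m≤m+n _ _) (order-deletion del))
  ; sparse     = begin
      Graph.size G + q        ≤⟨ +-monoˡ-≤ q (size-deletion del) ⟩
      Graph.size H + ℓ + q    ≡⟨ xy∙z≈xz∙y (Graph.size H) ℓ q ⟩
      Graph.size H + q + ℓ    ≤⟨ +-monoˡ-≤ ℓ sparse ⟩
      e + Graph.order H + ℓ   ≡⟨ +-assoc e _ ℓ ⟩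
      e + (Graph.order H + ℓ) ≤⟨ +-monoʳ-≤ e (order-deletion del) ⟩
      e + Graph.order G       ∎
  ; peeling    = proj₁ (proj₂ (Peeling-deletion del peeling exhaustive))
  ; exhaustive = proj₂ (proj₂ (Peeling-deletion del peeling exhaustive))
  }
  where
  open Peelable peelable
  open ≤-Reasoning
  ℓ : ℕ
  ℓ = length (filter (leaf? G) (allFin (Graph.order G)))

Peelable-self : ∀ G → Peelable (Graph.order G) (Graph.size G) G
Peelable-self G = record
  { core≤order = ≤-refl
  ; sparse     = ≤-refl
  ; peeling    = core (Uniqueₚ.allFin⁺ _) (≤-reflexive (length-tabulate id))
  ; exhaustive = ∈-allFin
  }

-- Induction on the number `d` of deletions that lead from Gᵢ to the final graph.
Peelable-chain : (G : ℕ → Graph) → ∀ a → (∀ i → 1 ≤ i → i < a → LeafDeletion (G i) (G (suc i))) →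
                 ∀ d i → 1 ≤ i → d + i ≡ a →
                 Peelable (Graph.order (G a)) (Graph.size (G a)) (G i)
Peelable-chain G a del zero    i 1≤i refl = Peelable-self (G i)
Peelable-chain G a del (suc d) i 1≤i eq = Peelable-deletion
  (del i 1≤i (≤-trans (s≤s (m≤n+m i d)) (≤-reflexive eq)))
  (Peelable-chain G a del d (suc i) (s≤s z≤n) (trans (+-suc d i) eq))

-- Greedy rainbow embeddings

module _ {k n : ℕ} (c : EdgeColouring k n) (G : Graph) where
  open EdgeColouring c
  open Graph G
  open import Data.List.Membership.DecPropositional (Finₚ._≟_ {order}) using (_∈?_)

  -- f embeds the vertices in P; its other values are junk.
  record PartialRainbow (f : Vertex → Fin n) (P : List Vertex) : Set where
    field
      injective : ∀ {u v} → u ∈ P → v ∈ P → f u ≡ f v → u ≡ v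
      rainbow   : ∀ {u v x y} → u ∈ P → v ∈ P → x ∈ P → y ∈ P → u ~ v → x ~ y →
                  colour (f u) (f v) ≡ colour (f x) (f y) →
                  (u ≡ x × v ≡ y) ⊎ (u ≡ y × v ≡ x)

  Within : List Vertex → Pred (Vertex × Vertex) 0ℓ
  Within P (u , v) = u ∈ P × v ∈ P

  within? : ∀ P → Decidable (Within P)
  within? P (u , v) = (u ∈? P) ×-dec (v ∈? P)

  used : (Vertex → Fin n) → List Vertex → List (Fin k)
  used f P = map (λ (u , v) → colour (f u) (f v)) (filter (within? P) edges)

  ∈-used : ∀ {f P u v} → u ∈ P → v ∈ P → u ~ v → colour (f u) (f v) ∈ used f P
  ∈-used {f} {P} {u} {v} u∈P v∈P u~v with ∈-edges-⊎ G u~v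
  ... | inj₁ uv∈ = ∈-map⁺ _ (∈-filter⁺ (within? P) uv∈ (u∈P , v∈P))
  ... | inj₂ vu∈ = subst (_∈ used f P) (colour-sym (f v) (f u))
                     (∈-map⁺ _ (∈-filter⁺ (within? P) vu∈ (v∈P , u∈P)))

  length-used≤² : ∀ f P → length (used f P) ≤ length P * length P
  length-used≤² f P = begin
    length (used f P)                  ≡⟨ length-map _ (filter (within? P) edges) ⟩
    length (filter (within? P) edges)  ≤⟨ Unique-⊆⇒length-≤ (Uniqueₚ.filter⁺ (within? P) (edges-unique G)) within⇒× ⟩
    length (cartesianProduct P P)      ≡⟨ length-cartesianProduct P P ⟩
    length P * length P                ∎
    where
    open ≤-Reasoning
    within⇒× : filter (within? P) edges ⊆ cartesianProduct P P
    within⇒× {u , v} uv∈ with u∈P , v∈P ← proj₂ (∈-filter⁻ (within? P) {xs = edges} uv∈) =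
      ∈-cartesianProduct⁺ u∈P v∈P

  -- The edge from `x` to `u` does not lie within `P`, so its colour is not counted. The strictness
  -- leaves room for the old images, which must be avoided too.
  length-used<size : ∀ f {P x u} → x ∉ P → x ~ u → length (used f P) < size
  length-used<size f {P} {x} {u} x∉P x~u = ≤-trans
    (s≤s (≤-reflexive (length-map _ (filter (within? P) edges))))
    (filter-notAll (within? P) edges outside)
    where
    outside : Any (λ e → ¬ Within P e) edges
    outside with ∈-edges-⊎ G x~u
    ... | inj₁ xu∈ = lose xu∈ (x∉P ∘ proj₁)
    ... | inj₂ ux∈ = lose ux∈ (x∉P ∘ proj₂)

  _[_↦_] : (Vertex → Fin n) → Vertex → Fin n → Vertex → Fin n
  f [ x ↦ a ] = updateAt f x (const a)

  ↦-new : ∀ f x a → (f [ x ↦ a ]) x ≡ a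
  ↦-new f x a = updateAt-updates x f

  ↦-old : ∀ f {x P} a → x ∉ P → ∀ {u} → u ∈ P → (f [ x ↦ a ]) u ≡ f u
  ↦-old f {x} {P} a x∉P {u} u∈P = updateAt-minimal u x f (λ u≡x → x∉P (subst (_∈ P) u≡x u∈P))

  module _ {f : Vertex → Fin n} {P : List Vertex} (pr : PartialRainbow f P) {x : Vertex} (x∉P : x ∉ P) {a : Fin n}
           (fresh : ∀ {u} → u ∈ P → f u ≢ a)
           (unused : ∀ {u} → u ∈ P → x ~ u → colour a (f u) ∉ used f P)
           (distinct : ∀ {u v} → u ∈ P → v ∈ P → x ~ u → x ~ v → colour a (f u) ≡ colour a (f v) → u ≡ v)
           where
    private
      open PartialRainbow pr

      g : Vertex → Fin n
      g = f [ x ↦ a ]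

      g-old : ∀ {u} → u ∈ P → g u ≡ f u
      g-old = ↦-old f a x∉P

      col : Vertex → Vertex → Fin k
      col u v = colour (g u) (g v)

      -- Sorts the edges of the extended embedding by whether they contain `x`, and brings new
      -- colours into the form `colour a (f u)` in either orientation.
      data View : Vertex → Vertex → Set where
        old  : ∀ {u v} → u ∈ P → v ∈ P → col u v ≡ colour (f u) (f v) → View u v
        newˡ : ∀ {u} → u ∈ P → x ~ u → col x u ≡ colour a (f u) → View x u
        newʳ : ∀ {u} → u ∈ P → x ~ u → col u x ≡ colour a (f u) → View u x

      view : ∀ {u v} → u ∈ x ∷ P → v ∈ x ∷ P → u ~ v → View u v
      view (here refl) (here refl) u~v = contradiction u~v (~-irrefl refl)
      view (here refl) (there v∈) u~v = newˡ v∈ u~v (cong₂ colour (↦-new f x a) (g-old v∈))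
      view (there u∈) (here refl) u~v = newʳ u∈ (~-sym u~v)
        (trans (cong₂ colour (g-old u∈) (↦-new f x a)) (colour-sym _ _))
      view (there u∈) (there v∈) u~v = old u∈ v∈ (cong₂ colour (g-old u∈) (g-old v∈))

      clash : ∀ {u v w} → u ∈ P → v ∈ P → u ~ v → w ∈ P → x ~ w →
              colour (f u) (f v) ≢ colour a (f w)
      clash u∈ v∈ u~v w∈ x~w eq = unused w∈ x~w (subst (_∈ used f P) eq (∈-used u∈ v∈ u~v))

      same : ∀ {u v} {i j : Fin k} → u ∈ P → v ∈ P → x ~ u → x ~ v →
             i ≡ colour a (f u) → j ≡ colour a (f v) → i ≡ j → u ≡ v
      same u∈ v∈ x~u x~v i≡ j≡ i≡j = distinct u∈ v∈ x~u x~v (trans (sym i≡) (trans i≡j j≡))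

      g-rainbow : ∀ {u v y z} → View u v → View y z → u ~ v → y ~ z → col u v ≡ col y z →
                  (u ≡ y × v ≡ z) ⊎ (u ≡ z × v ≡ y)
      g-rainbow (old u∈ v∈ p) (old y∈ z∈ q) u~v y~z eq =
        rainbow u∈ v∈ y∈ z∈ u~v y~z (trans (sym p) (trans eq q))
      g-rainbow (old u∈ v∈ p) (newˡ w∈ x~w q) u~v _ eq =
        contradiction (trans (sym p) (trans eq q)) (clash u∈ v∈ u~v w∈ x~w)
      g-rainbow (old u∈ v∈ p) (newʳ w∈ x~w q) u~v _ eq =
        contradiction (trans (sym p) (trans eq q)) (clash u∈ v∈ u~v w∈ x~w)
      g-rainbow (newˡ w∈ x~w q) (old u∈ v∈ p) _ u~v eq =
        contradiction (trans (sym p) (trans (sym eq) q)) (clash u∈ v∈ u~v w∈ x~w)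
      g-rainbow (newʳ w∈ x~w q) (old u∈ v∈ p) _ u~v eq =
        contradiction (trans (sym p) (trans (sym eq) q)) (clash u∈ v∈ u~v w∈ x~w)
      g-rainbow (newˡ u∈ x~u p) (newˡ v∈ x~v q) _ _ eq = inj₁ (refl , same u∈ v∈ x~u x~v p q eq)
      g-rainbow (newˡ u∈ x~u p) (newʳ v∈ x~v q) _ _ eq = inj₂ (refl , same u∈ v∈ x~u x~v p q eq)
      g-rainbow (newʳ u∈ x~u p) (newˡ v∈ x~v q) _ _ eq = inj₂ (same u∈ v∈ x~u x~v p q eq , refl)
      g-rainbow (newʳ u∈ x~u p) (newʳ v∈ x~v q) _ _ eq = inj₁ (same u∈ v∈ x~u x~v p q eq , refl)

    extend : PartialRainbow (f [ x ↦ a ]) (x ∷ P)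
    extend = record
      { injective = λ
          { (here refl) (here refl) _ → refl
          ; (here refl) (there v∈) eq → contradiction
              (trans (sym (g-old v∈)) (trans (sym eq) (↦-new f x a))) (fresh v∈)
          ; (there u∈) (here refl) eq → contradiction
              (trans (sym (g-old u∈)) (trans eq (↦-new f x a))) (fresh u∈)
          ; (there u∈) (there v∈) eq → injective u∈ v∈ (trans (sym (g-old u∈)) (trans eq (g-old v∈)))
          }
      ; rainbow = λ u∈ v∈ y∈ z∈ u~v y~z → g-rainbow (view u∈ v∈ u~v) (view y∈ z∈ y~z) u~v y~z
      }

-- Core vertices, chosen by averaging

module _ {k n : ℕ} (c : EdgeColouring k n) (G : Graph) (S : List (Fin n)) (b : ℕ)
         (low-degree : ∀ {v} → v ∈ S → ∀ i → length (filter (λ w → EdgeColouring.colour c v w Finₚ.≟ i) S) ≤ b)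
         where
  open EdgeColouring c
  open Graph G
  open import Data.List.Membership.DecPropositional (Finₚ._≟_ {n}) using (_∈?_)

  private
    Hits : Fin n × Fin k → Fin n → Set
    Hits (v , i) w = colour v w ≡ i

    hits? : ∀ e → Decidable (Hits e)
    hits? (v , i) w = colour v w Finₚ.≟ i

    Forbidden : List (Fin n × Fin k) → Fin n → Set
    Forbidden es w = Any (λ e → Hits e w) es

    forbidden? : ∀ es → Decidable (Forbidden es)
    forbidden? es w = any? (λ e → hits? e w) es

  -- `T` holds the candidates for later images: they see all images chosen so far in distinct
  -- colours. The loss is quadratic because vertex number j + 1 costs at most 2jb candidates, and 2j
  -- < (j + 1)² - j².
  record CoreEmbedding (P : List Vertex) : Set where
    field
      f          : Vertex → Fin n
      isRainbow  : PartialRainbow c G f P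
      image⊆     : ∀ {u} → u ∈ P → f u ∈ S
      T          : List (Fin n)
      T⊆S        : T ⊆ S
      T-degree   : ∀ {v} → v ∈ S → ∀ i → length (filter (hits? (v , i)) T) ≤ b
      separating : ∀ {w} → w ∈ T → ∀ {u v} → u ∈ P → v ∈ P → colour (f u) w ≡ colour (f v) w → u ≡ v
      T-large    : length S ≤ length T + length P * length P * b

  module _ {P : List Vertex} (E : CoreEmbedding P) {x : Vertex} (x∉P : x ∉ P)
           (S-large : 2 * suc (length P) ^ 3 * b ≤ length S) (b>0 : 1 ≤ b) where
    open CoreEmbedding E
    private
      j : ℕ
      j = length P

      -- Both demands on a new image become colours forbidden at old images, each costing at most
      -- `b` candidates. Forbidding the diagonal colour at `f u`, whatever its value, excludes `f u`
      -- itself; the other pairs exclude used colours.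
      bans : List (Fin n × Fin k)
      bans = map (λ u → f u , colour (f u) (f u)) P ++ cartesianProduct (map f P) (used c G f P)

      bans-in-S : ∀ {e} → e ∈ bans → proj₁ e ∈ S
      bans-in-S e∈ with ∈-++⁻ (map _ P) e∈
      ... | inj₁ e∈₁ with u , u∈ , refl ← ∈-map⁻ _ e∈₁ = image⊆ u∈
      ... | inj₂ e∈₂ with v∈ , _ ← ∈-cartesianProduct⁻ (map f P) (used c G f P) e∈₂
                     with u , u∈ , refl ← ∈-map⁻ f v∈ = image⊆ u∈

      length-bans : length bans ≤ j + j * (j * j)
      length-bans = begin
        length bans                   ≡⟨ length-++ (map _ P) ⟩
        length (map _ P) + length (cartesianProduct (map f P) (used c G f P))
          ≡⟨ cong₂ _+_ (length-map _ P) (length-cartesianProduct (map f P) (used c G f P)) ⟩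
        j + length (map f P) * length (used c G f P) ≡⟨ cong (λ l → j + l * length (used c G f P)) (length-map f P) ⟩
        j + j * length (used c G f P) ≤⟨ +-monoʳ-≤ j (*-monoʳ-≤ j (length-used≤² c G f P)) ⟩
        j + j * (j * j)               ∎
        where open ≤-Reasoning

      T₁ : List (Fin n)
      T₁ = filter (¬? ∘ forbidden? bans) T

      banned : ℕ
      banned = (j + j * (j * j)) * b

      T≤banned+T₁ : length T ≤ banned + length T₁
      T≤banned+T₁ = begin
        length T ≡⟨ length-filter-∁ (forbidden? bans) T ⟨
        length (filter (forbidden? bans) T) + length T₁
          ≤⟨ +-monoˡ-≤ (length T₁) (length-filter-any hits? b bans T λ e∈ → T-degree (bans-in-S e∈) _) ⟩
        length bans * b + length T₁ ≤⟨ +-monoˡ-≤ (length T₁) (*-monoˡ-≤ b length-bans) ⟩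
        banned + length T₁ ∎
        where open ≤-Reasoning

      -- Together with `T≤banned+T₁` this makes `T₁` more than half of `T`, as the averaging
      -- requires.
      banned<T₁ : suc banned ≤ length T₁
      banned<T₁ = +-cancelˡ-≤ (j * j * b + banned) _ _ (begin
        j * j * b + banned + suc banned          ≤⟨ +-monoʳ-≤ (j * j * b + banned) (+-monoˡ-≤ banned b>0) ⟩
        -- The added slack completes j² + 2(j + j³) + 1 to 2(j + 1)³.
        j * j * b + banned + (b + banned)        ≤⟨ m≤m+n _ ((1 + 4 * j + 5 * (j * j)) * b) ⟩
        j * j * b + banned + (b + banned) + (1 + 4 * j + 5 * (j * j)) * b ≡⟨ identity j b ⟩
        2 * suc j ^ 3 * b                        ≤⟨ S-large ⟩
        length S                                 ≤⟨ T-large ⟩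
        length T + j * j * b                     ≤⟨ +-monoˡ-≤ (j * j * b) T≤banned+T₁ ⟩
        banned + length T₁ + j * j * b           ≡⟨ xy∙z≈zx∙y banned (length T₁) (j * j * b) ⟩
        j * j * b + banned + length T₁           ∎)
        where
        open ≤-Reasoning
        identity : ∀ j b → j * j * b + (j + j * (j * j)) * b + (b + (j + j * (j * j)) * b)
                           + (1 + 4 * j + 5 * (j * j)) * b ≡ 2 * (suc j * (suc j * (suc j * 1))) * b
        identity = solve-∀

      Similar : Fin n → Fin n → Set
      Similar v w = Any (λ u → colour v w ≡ colour (f u) w) P

      similar? : ∀ v → Decidable (Similar v)
      similar? v w = any? (λ u → colour v w Finₚ.≟ colour (f u) w) P

      -- Each `v` counted here is joined to `w` in one of the at most `j` colours between `w` and
      -- old images, and `w` has at most `b` neighbours in each.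
      few-similar : ∀ {w} → w ∈ T → length (filter (λ v → similar? v w) T₁) ≤ j * b
      few-similar {w} w∈T = length-filter-any (λ u v → colour v w Finₚ.≟ colour (f u) w) b P T₁ λ {u} _ →
        ≤-trans (length-filter-filter _ _ T)
          (≤-trans (length-filter-mono _ (hits? (w , colour (f u) w)) (λ {v} → trans (colour-sym w v)) T)
                   (T-degree (T⊆S w∈T) _))

      -- As |T| ≤ 2|T₁| and `T₁` is nonempty, the members of `T₁` have on average fewer than 2jb + 1
      -- similar vertices in `T`.
      sparse : length T * (j * b) < length T₁ * suc (2 * (j * b))
      sparse = begin-strict
        length T * (j * b)                   ≤⟨ *-monoˡ-≤ (j * b) T≤banned+T₁ ⟩
        (banned + length T₁) * (j * b)       ≤⟨ *-monoˡ-≤ (j * b) (+-monoˡ-≤ (length T₁) (<⇒≤ banned<T₁)) ⟩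
        (length T₁ + length T₁) * (j * b)    <⟨ m<n+m _ (≤-trans (s≤s z≤n) banned<T₁) ⟩
        length T₁ + (length T₁ + length T₁) * (j * b) ≡⟨ identity (length T₁) (j * b) ⟩
        length T₁ * suc (2 * (j * b))        ∎
        where
        open ≤-Reasoning
        identity : ∀ t d → t + (t + t) * d ≡ t * suc (2 * d)
        identity = solve-∀

      chosen : ∃ λ a → a ∈ T₁ × length (filter (similar? a) T) ≤ 2 * (j * b)
      chosen = sparse-row similar? T₁ T few-similar sparse

      a : Fin n
      a = proj₁ chosen

      a∈T : a ∈ T
      a∈T = proj₁ (∈-filter⁻ (¬? ∘ forbidden? bans) {xs = T} (proj₁ (proj₂ chosen)))

      allowed : ∀ {e} → e ∈ bans → ¬ Hits e a
      allowed e∈ hit = proj₂ (∈-filter⁻ (¬? ∘ forbidden? bans) {xs = T} (proj₁ (proj₂ chosen))) (lose e∈ hit)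

      fresh : ∀ {u} → u ∈ P → f u ≢ a
      fresh {u} u∈ fu≡a = allowed (∈-++⁺ˡ (∈-map⁺ _ u∈)) (cong (colour (f u)) (sym fu≡a))

      unused : ∀ {u} → u ∈ P → x ~ u → colour a (f u) ∉ used c G f P
      unused {u} u∈ _ i∈ = allowed (∈-++⁺ʳ (map _ P) (∈-cartesianProduct⁺ (∈-map⁺ f u∈) i∈)) (colour-sym (f u) a)

      distinct : ∀ {u v} → u ∈ P → v ∈ P → x ~ u → x ~ v → colour a (f u) ≡ colour a (f v) → u ≡ v
      distinct u∈ v∈ _ _ eq = separating a∈T u∈ v∈ (trans (colour-sym _ a) (trans eq (colour-sym a _)))

      g : Vertex → Fin n
      g = _[_↦_] c G f x a

      g-new : g x ≡ a
      g-new = ↦-new c G f x a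

      g-old : ∀ {u} → u ∈ P → g u ≡ f u
      g-old = ↦-old c G f a x∉P

      -- Filtered from `T` and not from `T₁`: the bans concern only the image of `x` and are drawn
      -- up afresh for the next vertex.
      T₂ : List (Fin n)
      T₂ = filter (¬? ∘ similar? a) T

      ∈-T₂ : ∀ {w} → w ∈ T₂ → w ∈ T × ¬ Similar a w
      ∈-T₂ = ∈-filter⁻ (¬? ∘ similar? a) {xs = T}

      separating₂ : ∀ {w} → w ∈ T₂ → ∀ {u v} → u ∈ x ∷ P → v ∈ x ∷ P → colour (g u) w ≡ colour (g v) w → u ≡ v
      separating₂ w∈ (here refl) (here refl) eq = refl
      separating₂ {w} w∈ (here refl) (there v∈) eq = contradiction
        (lose v∈ (trans (cong (λ z → colour z w) (sym g-new)) (trans eq (cong (λ z → colour z w) (g-old v∈)))))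
        (proj₂ (∈-T₂ w∈))
      separating₂ {w} w∈ (there u∈) (here refl) eq = contradiction
        (lose u∈ (trans (cong (λ z → colour z w) (sym g-new)) (trans (sym eq) (cong (λ z → colour z w) (g-old u∈)))))
        (proj₂ (∈-T₂ w∈))
      separating₂ {w} w∈ (there u∈) (there v∈) eq = separating (proj₁ (∈-T₂ w∈)) u∈ v∈
        (trans (cong (λ z → colour z w) (sym (g-old u∈))) (trans eq (cong (λ z → colour z w) (g-old v∈))))

      T₂-large : length S ≤ length T₂ + suc j * suc j * b
      T₂-large = begin
        length S                                             ≤⟨ T-large ⟩
        length T + j * j * b                                 ≡⟨ cong (_+ j * j * b) (length-filter-∁ (similar? a) T) ⟨
        length (filter (similar? a) T) + length T₂ + j * j * b ≤⟨ +-monoˡ-≤ (j * j * b) (+-monoˡ-≤ (length T₂) (proj₂ (proj₂ chosen))) ⟩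
        2 * (j * b) + length T₂ + j * j * b                  ≤⟨ m≤m+n _ b ⟩
        2 * (j * b) + length T₂ + j * j * b + b              ≡⟨ identity (length T₂) j b ⟩
        length T₂ + suc j * suc j * b                        ∎
        where
        open ≤-Reasoning
        identity : ∀ t j b → 2 * (j * b) + t + j * j * b + b ≡ t + suc j * suc j * b
        identity = solve-∀

    extend-core : CoreEmbedding (x ∷ P)
    extend-core = record
      { f          = g
      ; isRainbow  = extend c G isRainbow x∉P fresh unused distinct
      ; image⊆     = λ { (here refl) → subst (_∈ S) (sym g-new) (T⊆S a∈T)
                       ; (there u∈) → subst (_∈ S) (sym (g-old u∈)) (image⊆ u∈) }
      ; T          = T₂
      ; T⊆S        = T⊆S ∘ proj₁ ∘ ∈-T₂
      ; T-degree   = λ v∈ i → ≤-trans (length-filter-filter (¬? ∘ similar? a) (hits? (_ , i)) T) (T-degree v∈ i)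
      ; separating = separating₂
      ; T-large    = T₂-large
      }

  embed-core : ∀ p → 2 * p ^ 3 * b ≤ length S → 1 ≤ b → 1 ≤ length S →
               ∀ {P} → Unique P → length P ≤ p → CoreEmbedding P
  embed-core p S-large b>0 S>0 [] _ = record
    -- A dummy value, as no vertex is embedded yet.
    { f          = const (lookup S (Fin.fromℕ< S>0))
    ; isRainbow  = record { injective = λ () ; rainbow = λ () }
    ; image⊆     = λ ()
    ; T          = S
    ; T⊆S        = id
    ; T-degree   = low-degree
    ; separating = λ _ ()
    ; T-large    = m≤m+n _ 0
    }
  embed-core p S-large b>0 S>0 P!@(_ ∷ P′!) P≤p = extend-core
    (embed-core p S-large b>0 S>0 P′! (<⇒≤ P≤p))
    (Uniqueₚ.Unique[x∷xs]⇒x∉xs P!)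
    (≤-trans (*-monoˡ-≤ b (*-monoʳ-≤ 2 (^-monoˡ-≤ 3 P≤p))) S-large)
    b>0

  -- Pendant vertices, placed by counting excluded images

  module _ (S! : Unique S) {M : ℕ} (S-large : M * b ≤ length S) (size≤M : size ≤ M) (order≤b : order ≤ b)
           (M>0 : 1 ≤ M) (b>0 : 1 ≤ b) where

    open ≤-Reasoning

    private
      -- Fewer than `b` vertices are excluded by `xs` and at most (M - 1)b by the bans, in total
      -- fewer than Mb.
      avoid : ∀ xs → length xs < b → ∀ es → (∀ {e} → e ∈ es → proj₁ e ∈ S) → length es < M →
              ∃ λ a → a ∈ S × a ∉ xs × (∀ {e} → e ∈ es → ¬ Hits e a)
      avoid xs short es es-in-S few =
        let a , a∈S , ok = filter-escape bad? S (begin-strict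
              length (filter bad? S)
                ≤⟨ length-filter-⊎ bad? (_∈? xs) (forbidden? es) id S ⟩
              length (filter (_∈? xs) S) + length (filter (forbidden? es) S)
                ≤⟨ +-mono-≤ (Unique-⊆⇒length-≤ (Uniqueₚ.filter⁺ (_∈? xs) S!) (proj₂ ∘ ∈-filter⁻ (_∈? xs) {xs = S}))
                            (length-filter-any hits? b es S λ e∈ → low-degree (es-in-S e∈) _) ⟩
              length xs + length es * b <⟨ +-monoˡ-< (length es * b) short ⟩
              b + length es * b         ≤⟨ *-monoˡ-≤ b few ⟩
              M * b                     ≤⟨ S-large ⟩
              length S                  ∎)
        in  a , a∈S , ok ∘ inj₁ , λ e∈ hit → ok (inj₂ (lose e∈ hit))
        where
        bad? : Decidable (λ w → w ∈ xs ⊎ Forbidden es w)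
        bad? w = (w ∈? xs) ⊎-dec forbidden? es w

      short : ∀ (f : Vertex → Fin n) {x P} → Unique (x ∷ P) → length (map f P) < b
      short f {P = P} P! = begin-strict
        length (map f P)      ≡⟨ length-map f P ⟩
        length P              <⟨ Unique-⊆⇒length-≤ P! (λ _ → ∈-allFin _) ⟩
        length (allFin order) ≡⟨ length-tabulate {n = order} id ⟩
        order                 ≤⟨ order≤b ⟩
        b                     ∎

      -- If `x` has an earlier neighbour `u`, all bans sit at `f u`, one for each used colour;
      -- otherwise only the old images must be avoided.
      pendant-image : ∀ {f P x} → Unique (x ∷ P) → (∀ {u} → u ∈ P → f u ∈ S) →
                      (∀ {u v} → u ∈ P → v ∈ P → x ~ u → x ~ v → u ≡ v) →
                      ∃ λ a → a ∈ S × a ∉ map f P × (∀ {u} → u ∈ P → x ~ u → colour a (f u) ∉ used c G f P)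
      pendant-image {f} {P} {x} P! image⊆ one-neighbour with any? (x ~?_) P
      ... | no none =
        let a , a∈S , a∉ , _ = avoid (map f P) (short f P!) [] (λ ()) M>0
        in  a , a∈S , a∉ , λ u∈ x~u → contradiction (lose u∈ x~u) none
      ... | yes some with u , u∈ , x~u ← find some =
        let a , a∈S , a∉ , allowed = avoid (map f P) (short f P!) (map (f u ,_) (used c G f P)) in-S few
        in  a , a∈S , a∉ , λ v∈ x~v i∈ → allowed
              (∈-map⁺ (f u ,_) (subst (λ v → colour a (f v) ∈ used c G f P) (one-neighbour v∈ u∈ x~v x~u) i∈))
              (colour-sym (f u) a)
        where
        in-S : ∀ {e} → e ∈ map (f u ,_) (used c G f P) → proj₁ e ∈ S
        in-S e∈ with _ , _ , refl ← ∈-map⁻ (f u ,_) e∈ = image⊆ u∈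
        few : length (map (f u ,_) (used c G f P)) < M
        few = begin-strict
          length (map (f u ,_) (used c G f P)) ≡⟨ length-map _ (used c G f P) ⟩
          length (used c G f P)                <⟨ length-used<size c G f (Uniqueₚ.Unique[x∷xs]⇒x∉xs P!) x~u ⟩
          size                                 ≤⟨ size≤M ⟩
          M                                    ∎

    embed-peeling : ∀ {q P} → (∀ {Q} → Unique Q → length Q ≤ q → CoreEmbedding Q) → Peeling G q P →
                    ∃ λ f → PartialRainbow c G f P × (∀ {u} → u ∈ P → f u ∈ S)
    embed-peeling embed (core P! P≤q) = f , isRainbow , image⊆
      where open CoreEmbedding (embed P! P≤q)
    embed-peeling embed peel@(pendant {x} {P} x∉P one-neighbour peel′) =
      let f , isRainbow , image⊆ = embed-peeling embed peel′
          a , a∈S , a∉ , unused = pendant-image (Peeling-unique peel) image⊆ one-neighbour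
          g = _[_↦_] c G f x a
          g-image : ∀ {u} → u ∈ x ∷ P → g u ∈ S
          g-image = λ { (here refl) → subst (_∈ S) (sym (↦-new c G f x a)) a∈S
                      ; (there u∈) → subst (_∈ S) (sym (↦-old c G f a x∉P u∈)) (image⊆ u∈) }
      in  g
        , extend c G isRainbow x∉P
            (λ v∈ eq → a∉ (subst (_∈ map f P) eq (∈-map⁺ f v∈)))
            unused
            -- At most one new edge arises, so new edges cannot clash with each other.
            (λ v∈ w∈ x~v x~w _ → one-neighbour v∈ w∈ x~v x~w)
        , g-image

    rainbow-copy : ∀ {p P} → 2 * p ^ 3 * b ≤ length S → Peeling G p P → (∀ v → v ∈ P) →
                   ∃ λ (f : Copy G n) → Rainbow c G f
    rainbow-copy {p} S-large′ peel all∈P =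
      let f , isRainbow , _ = embed-peeling (embed-core p S-large′ b>0 S>0) peel
          open PartialRainbow isRainbow
      in  mk↣ {to = f} (injective (all∈P _) (all∈P _)) ,
          rainbow (all∈P _) (all∈P _) (all∈P _) (all∈P _)
      where
      S>0 : 1 ≤ length S
      S>0 = ≤-trans (*-mono-≤ M>0 b>0) S-large

-- The Ramsey recursion

mono-copy : ∀ {k n} (c : EdgeColouring k n) → let open EdgeColouring c in ∀ {i t} (vs : List (Fin n)) →
            AllPairs (λ v w → v ≢ w × colour v w ≡ i) vs → t ≤ length vs →
            ∃ λ (f : Copy (K t) n) → Monochromatic c (K t) f
mono-copy {n = n} c {i} {t} vs clique t≤ = mk↣ f-injective , λ u≢v x≢y → trans (f-colour u≢v) (sym (f-colour x≢y))
  where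
  open EdgeColouring c
  f : Fin t → Fin n
  f j = lookup vs (Fin.inject≤ j t≤)

  f-link : ∀ {u v} → u ≢ v → f u ≢ f v × colour (f u) (f v) ≡ i
  f-link u≢v = lookup-allPairs (λ (v≢w , eq) → ≢-sym v≢w , trans (colour-sym _ _) eq) clique
    (u≢v ∘ Finₚ.inject≤-injective t≤ t≤ _ _)

  f-injective : ∀ {u v} → f u ≡ f v → u ≡ v
  f-injective {u} {v} eq = decidable-stable (u Finₚ.≟ v) λ u≢v → proj₁ (f-link u≢v) eq

  f-colour : ∀ {u v} → u ≢ v → colour (f u) (f v) ≡ i
  f-colour = proj₂ ∘ f-link

length-filter-≡ : ∀ {n} {S : List (Fin n)} → Unique S → ∀ v → length (filter (Finₚ._≟ v) S) ≤ 1
length-filter-≡ {S = S} S! v = Unique-⊆⇒length-≤ {ys = [ v ]} (Uniqueₚ.filter⁺ (Finₚ._≟ v) S!)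
  (here ∘ proj₂ ∘ ∈-filter⁻ (Finₚ._≟ v) {xs = S})

module _ {k n : ℕ} (c : EdgeColouring k n) where
  open EdgeColouring c

  -- Excludes `v`, whose diagonal colour is arbitrary; this also keeps the vertices picked in the
  -- recursion distinct.
  colourClass? : ∀ v i → Decidable (λ w → w ≢ v × colour v w ≡ i)
  colourClass? v i w = ¬? (w Finₚ.≟ v) ×-dec (colour v w Finₚ.≟ i)

  colourClass : Fin n → Fin k → List (Fin n) → List (Fin n)
  colourClass v i = filter (colourClass? v i)

  -- Each entry of a chain is a picked vertex with the colour that joins it to all vertices picked
  -- later.
  Link : Rel (Fin n × Fin k) 0ℓ
  Link (v , i) (w , _) = w ≢ v × colour v w ≡ i

  -- If all `k` classes had at most `b` vertices, then `S`, with `v` included, would have at most 1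
  -- + kb < M + Mb.
  big-class : ∀ {M b S} → Unique S → 2 ≤ M → k ≤ M → M * suc b ≤ length S → ∀ v →
              ∃ λ i → suc b ≤ length (colourClass v i S)
  big-class {M} {b} {S} S! 2≤M k≤M S-large v
    with Finₚ.any? (λ i → suc b ≤? length (colourClass v i S))
  ... | yes big = big
  ... | no none = ⊥-elim (proj₂ (proj₂ escaped) (classify _))
    where
    open ≤-Reasoning
    classified? : Decidable (λ w → w ≡ v ⊎ Any (λ i → w ≢ v × colour v w ≡ i) (allFin k))
    classified? w = (w Finₚ.≟ v) ⊎-dec any? (λ i → colourClass? v i w) (allFin k)

    classify : ∀ w → w ≡ v ⊎ Any (λ i → w ≢ v × colour v w ≡ i) (allFin k)
    classify w with w Finₚ.≟ v
    ... | yes w≡v = inj₁ w≡v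
    ... | no  w≢v = inj₂ (lose (∈-allFin (colour v w)) (w≢v , refl))

    escaped : ∃ λ w → w ∈ S × ¬ (w ≡ v ⊎ Any (λ i → w ≢ v × colour v w ≡ i) (allFin k))
    escaped = filter-escape classified? S (begin-strict
      length (filter classified? S)
        ≤⟨ length-filter-⊎ classified? (Finₚ._≟ v) (λ w → any? (λ i → colourClass? v i w) (allFin k)) id S ⟩
      length (filter (Finₚ._≟ v) S) + length (filter (λ w → any? (λ i → colourClass? v i w) (allFin k)) S)
        ≤⟨ +-mono-≤ (length-filter-≡ S! v)
             (length-filter-any (colourClass? v) b (allFin k) S (λ {i} _ → ≮⇒≥ λ big → none (i , big))) ⟩
      1 + length (allFin k) * b ≡⟨ cong (λ l → 1 + l * b) (length-tabulate {n = k} id) ⟩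
      1 + k * b                 <⟨ +-mono-<-≤ 2≤M (*-monoˡ-≤ b k≤M) ⟩
      M + M * b                 ≡⟨ *-suc M b ⟨
      M * suc b                 ≤⟨ S-large ⟩
      length S                  ∎)

  popular-colour : ∀ t (ps : List (Fin n × Fin k)) → k * t < length ps →
                   ∃ λ i → suc t ≤ length (filter (λ e → proj₂ e Finₚ.≟ i) ps)
  popular-colour t ps many with Finₚ.any? (λ i → suc t ≤? length (filter (λ e → proj₂ e Finₚ.≟ i) ps))
  ... | yes some = some
  ... | no none = ⊥-elim (proj₂ (proj₂ escaped) (lose (∈-allFin _) refl))
    where
    open ≤-Reasoning
    coloured? : Decidable (λ (e : Fin n × Fin k) → Any (proj₂ e ≡_) (allFin k))
    coloured? e = any? (proj₂ e Finₚ.≟_) (allFin k)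
    escaped : ∃ λ e → e ∈ ps × ¬ Any (proj₂ e ≡_) (allFin k)
    escaped = filter-escape coloured? ps (begin-strict
      length (filter coloured? ps)
        ≤⟨ length-filter-any (λ i e → proj₂ e Finₚ.≟ i) t (allFin k) ps (λ {i} _ → ≮⇒≥ λ big → none (i , big)) ⟩
      length (allFin k) * t ≡⟨ cong (_* t) (length-tabulate {n = k} id) ⟩
      k * t                 <⟨ many ⟩
      length ps             ∎)

  links⇒clique : ∀ {i ps} → AllPairs Link ps → All (λ e → proj₂ e ≡ i) ps →
                 AllPairs (λ v w → v ≢ w × colour v w ≡ i) (map proj₁ ps)
  links⇒clique []       []              = []
  links⇒clique (l ∷ ls) (refl ∷ colours) =
    Allₚ.map⁺ (All.map (λ (w≢v , eq) → ≢-sym w≢v , eq) l) ∷ links⇒clique ls colours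

  module _ {G : Graph} {p : ℕ} {P : List (Graph.Vertex G)} (peel : Peeling G p P) (all∈P : ∀ v → v ∈ P)
           (2≤M : 2 ≤ 2 * p ^ 3) (size≤M : Graph.size G ≤ 2 * p ^ 3) where

    private
      M : ℕ
      M = 2 * p ^ 3

      instance
        M≢0 : NonZero M
        M≢0 = >-nonZero (≤-trans (s≤s z≤n) 2≤M)

    RainbowCopy : Set
    RainbowCopy = ∃ λ (f : Copy G n) → Rainbow c G f

    -- For k ≤ M, pigeonhole gives a large class at any vertex of `S`. In the other case, if no
    -- class is large, all colour degrees are at most `b` and the greedy embedding yields a rainbow
    -- copy.
    majority : ∀ {S b} → Unique S → 1 ≤ b → M * b ≤ length S → k ≤ M ⊎ Graph.order G ≤ b →
               RainbowCopy ⊎ (∃₂ λ v i → v ∈ S × b ≤ length (colourClass v i S))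
    majority {S} {b} S! b>0 S-large small
      with any? (λ v → Finₚ.any? (λ i → b ≤? length (colourClass v i S))) S
    ... | yes some with v , v∈S , i , big ← find some = inj₂ (v , i , v∈S , big)
    majority {S} {suc b} S! b>0 S-large (inj₁ k≤M) | no none =
      contradiction (lose (∈-lookup first) (big-class S! 2≤M k≤M S-large (lookup S first))) none
      where
      first : Fin (length S)
      first = Fin.fromℕ< (≤-trans (*-mono-≤ (≤-trans (s≤s z≤n) 2≤M) b>0) S-large)
    majority {S} {b} S! b>0 S-large (inj₂ order≤b) | no none =
      inj₁ (rainbow-copy c G S b low-degree S! S-large size≤M order≤b (≤-trans (s≤s z≤n) 2≤M) b>0 S-large peel all∈P)
      where
      low-degree : ∀ {v} → v ∈ S → ∀ i → length (filter (λ w → colour v w Finₚ.≟ i) S) ≤ b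
      low-degree {v} v∈S i = ≤-trans
        (length-filter-⊎ _ (Finₚ._≟ v) (colourClass? v i) split S)
        -- The class has fewer than `b` vertices, which leaves room for `v` itself, counted if its
        -- diagonal colour is `i`.
        (≤-trans (+-monoˡ-≤ _ (length-filter-≡ S! v)) (≰⇒> λ big → none (lose v∈S (i , big))))
        where
        split : ∀ {w} → colour v w ≡ i → w ≡ v ⊎ (w ≢ v × colour v w ≡ i)
        split {w} eq with w Finₚ.≟ v
        ... | yes w≡v = inj₁ w≡v
        ... | no  w≢v = inj₂ (w≢v , eq)

    -- The reserve e keeps the degree bound M ^ (m + e) of each step at least the order of G.
    chain : ∀ {e} → k ≤ M ⊎ Graph.order G ≤ M ^ e → ∀ m {S} → Unique S → M ^ (m + e) ≤ length S →
            RainbowCopy ⊎ (∃ λ ps → length ps ≡ m × AllPairs Link ps × All (λ e → proj₁ e ∈ S) ps)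
    chain small zero S! S-large = inj₂ ([] , refl , [] , [])
    chain {e} small (suc m) {S} S! S-large
      with majority S! (m^n>0 M (m + e)) S-large (map₂ (λ o≤ → ≤-trans o≤ (^-monoʳ-≤ M (m≤n+m e m))) small)
    ... | inj₁ copy = inj₁ copy
    ... | inj₂ (v , i , v∈S , big) with chain {e} small m (Uniqueₚ.filter⁺ (colourClass? v i) S!) big
    ...   | inj₁ copy = inj₁ copy
    ...   | inj₂ (ps , length≡ , links , inside) = inj₂
            ( (v , i) ∷ ps , cong suc length≡
            , All.map (proj₂ ∘ ∈-filter⁻ (colourClass? v i) {xs = S}) inside ∷ links
            , v∈S ∷ All.map (proj₁ ∘ ∈-filter⁻ (colourClass? v i) {xs = S}) inside )

    -- The exponent k(t + 1) splits into kt + 1 steps, enough for some colour to occur t + 1 times,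
    -- and a reserve of e = k - 1. If k > M, then e ≥ M ≥ 2, so M^e ≥ M² ≥ 2M bounds the order of
    -- `G`.
    rainbow-or-mono : ∀ t → 1 ≤ k → Graph.order G ≤ 2 * M → M ^ (k * suc t) ≤ n →
                      RainbowCopy ⊎ (∃ λ (f : Copy (K (suc t)) n) → Monochromatic c (K (suc t)) f)
    rainbow-or-mono t (s≤s {n = e} z≤n) order≤2M n-large =
      [ inj₁ , inj₂ ∘ chain⇒mono ]′ (chain {e} small (suc (k * t)) (Uniqueₚ.allFin⁺ n) (begin
        M ^ (suc (k * t) + e) ≡⟨ cong (M ^_) (+-comm (suc (k * t)) e) ⟩
        M ^ (e + suc (k * t)) ≡⟨ cong (M ^_) (+-suc e (k * t)) ⟩
        M ^ (k + k * t)       ≡⟨ cong (M ^_) (*-suc k t) ⟨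
        M ^ (k * suc t)       ≤⟨ n-large ⟩
        n                     ≡⟨ length-tabulate {n = n} id ⟨
        length (allFin n)     ∎))
      where
      open ≤-Reasoning
      small : k ≤ M ⊎ Graph.order G ≤ M ^ e
      small with k ≤? M
      ... | yes k≤M = inj₁ k≤M
      ... | no  k≰M = inj₂ (begin
        Graph.order G ≤⟨ order≤2M ⟩
        2 * M         ≤⟨ *-monoˡ-≤ M 2≤M ⟩
        M * M         ≡⟨ cong (M *_) (*-identityʳ M) ⟨
        M ^ 2         ≤⟨ ^-monoʳ-≤ M (≤-trans 2≤M (≤-pred (≰⇒> k≰M))) ⟩
        M ^ e         ∎)

      chain⇒mono : (∃ λ ps → length ps ≡ suc (k * t) × AllPairs Link ps × All (λ e → proj₁ e ∈ allFin n) ps) →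
                   ∃ λ (f : Copy (K (suc t)) n) → Monochromatic c (K (suc t)) f
      chain⇒mono (ps , length≡ , links , _) =
        let i , many = popular-colour t ps (≤-reflexive (sym length≡))
            hit? = λ (e : Fin n × Fin k) → proj₂ e Finₚ.≟ i
        in  mono-copy c (map proj₁ (filter hit? ps))
              (links⇒clique (AllPairsₚ.filter⁺ hit? links) (Allₚ.all-filter hit? ps))
              (≤-trans many (≤-reflexive (sym (length-map proj₁ (filter hit? ps)))))

-- Deciding the Gallai-Ramsey property

-- Functions between finite sets are enumerated by codes. Decoding a code agrees with the function
-- only pointwise, hence the demand that `P` respect `≗`.
any-function? : ∀ {m n} {P : (Fin m → Fin n) → Set} → (∀ {f g} → f ≗ g → P f → P g) →
                Decidable P → Dec (∃ P)
any-function? resp P? = map′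
  (λ (i , p) → Fin.finToFun i , p)
  (λ (f , p) → Fin.funToFin f , resp (sym ∘ Finₚ.finToFun-funToFin f) p)
  (Finₚ.any? (P? ∘ Fin.finToFun))

all-functions? : ∀ {m n} {P : (Fin m → Fin n) → Set} → (∀ {f g} → f ≗ g → P f → P g) →
                 Decidable P → Dec (∀ f → P f)
all-functions? resp P? = map′
  (λ all f → resp (Finₚ.finToFun-funToFin f) (all (Fin.funToFin f)))
  (λ all i → all (Fin.finToFun i))
  (Finₚ.all? (P? ∘ Fin.finToFun))

module _ {n : ℕ} (G : Graph) where
  open Graph G

  any-copy? : {P : Copy G n → Set} →
              (∀ {f g} → Injection.to f ≗ Injection.to g → P f → P g) →
              Decidable P → Dec (∃ P)
  any-copy? {P} resp P? = map′
    (λ (_ , inj , p) → mk↣ inj , p)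
    (λ (f , p) → Injection.to f , (λ {u} {v} → Injection.injective f {u} {v}) , resp (λ _ → refl) p)
    (any-function? Good-resp good?)
    where
    Good : (Vertex → Fin n) → Set
    Good f = ∃ λ (inj : ∀ {u v} → f u ≡ f v → u ≡ v) → P (mk↣ inj)

    Good-resp : ∀ {f g} → f ≗ g → Good f → Good g
    Good-resp f≗g (inj , p) =
      (λ {u} {v} eq → inj (trans (f≗g u) (trans eq (sym (f≗g v))))) , resp f≗g p

    injective? : ∀ f → Dec (∀ {u v} → f u ≡ f v → u ≡ v)
    injective? f = map′ (λ all {u} {v} → all u v) (λ inj u v → inj {u} {v})
      (Finₚ.all? λ u → Finₚ.all? λ v → (f u Finₚ.≟ f v) →-dec (u Finₚ.≟ v))

    good? : Decidable Good
    good? f with injective? f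
    ... | no ¬inj = no (λ (inj , _) → ¬inj inj)
    ... | yes inj with P? (mk↣ inj)
    ...   | yes p = yes (inj , p)
    ...   | no ¬p = no λ (inj′ , p) → ¬p (resp (λ _ → refl) p)

module _ {k n : ℕ} (G : Graph) where
  open Graph G
  open EdgeColouring using (colour)

  Rainbow-resp : ∀ (c c′ : EdgeColouring k n) (f f′ : Copy G n) →
                 let open Injection in
                 (∀ u v → colour c (to f u) (to f v) ≡ colour c′ (to f′ u) (to f′ v)) →
                 Rainbow c G f → Rainbow c′ G f′
  Rainbow-resp _ _ _ _ same rainbow u~v x~y eq = rainbow u~v x~y (trans (same _ _) (trans eq (sym (same _ _))))

  Monochromatic-resp : ∀ (c c′ : EdgeColouring k n) (f f′ : Copy G n) →
                       let open Injection in
                       (∀ u v → colour c (to f u) (to f v) ≡ colour c′ (to f′ u) (to f′ v)) →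
                       Monochromatic c G f → Monochromatic c′ G f′
  Monochromatic-resp _ _ _ _ same mono u~v x~y = trans (sym (same _ _)) (trans (mono u~v x~y) (same _ _))

  module _ (c : EdgeColouring k n) where

    private
      all-edge-pairs? : {Q : Vertex → Vertex → Vertex → Vertex → Set} → (∀ u v x y → Dec (Q u v x y)) →
                        Dec (∀ {u v x y} → u ~ v → x ~ y → Q u v x y)
      all-edge-pairs? Q? = map′ (λ all {u} {v} {x} {y} → all u v x y) (λ all u v x y → all {u} {v} {x} {y})
        (Finₚ.all? λ u → Finₚ.all? λ v → Finₚ.all? λ x → Finₚ.all? λ y →
          (u ~? v) →-dec (x ~? y) →-dec Q? u v x y)

    Rainbow? : ∀ f → Dec (Rainbow c G f)
    Rainbow? f = all-edge-pairs? λ u v x y →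
      (colour c (to u) (to v) Finₚ.≟ colour c (to x) (to y)) →-dec
      (((u Finₚ.≟ x) ×-dec (v Finₚ.≟ y)) ⊎-dec ((u Finₚ.≟ y) ×-dec (v Finₚ.≟ x)))
      where open Injection f using (to)

    Monochromatic? : ∀ f → Dec (Monochromatic c G f)
    Monochromatic? f = all-edge-pairs? λ u v x y → colour c (to u) (to v) Finₚ.≟ colour c (to x) (to y)
      where open Injection f using (to)

module _ (k : ℕ) (G H : Graph) where

  Outcome : ∀ {n} → EdgeColouring k n → Set
  Outcome {n} c = (∃ λ (f : Copy G n) → Rainbow c G f) ⊎ (∃ λ (f : Copy H n) → Monochromatic c H f)

  Outcome? : ∀ {n} → Decidable (Outcome {n})
  Outcome? c =
    any-copy? G (λ {f} {g} f≗g → Rainbow-resp G c c f g λ u v → cong₂ (EdgeColouring.colour c) (f≗g u) (f≗g v)) (Rainbow? G c)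
    ⊎-dec
    any-copy? H (λ {f} {g} f≗g → Monochromatic-resp H c c f g λ u v → cong₂ (EdgeColouring.colour c) (f≗g u) (f≗g v)) (Monochromatic? H c)

  Outcome-resp : ∀ {n} (c c′ : EdgeColouring k n) →
                 (∀ u v → EdgeColouring.colour c u v ≡ EdgeColouring.colour c′ u v) → Outcome c → Outcome c′
  Outcome-resp c c′ same (inj₁ (f , rainbow)) = inj₁ (f , Rainbow-resp G c c′ f f (λ u v → same _ _) rainbow)
  Outcome-resp c c′ same (inj₂ (f , mono))    = inj₂ (f , Monochromatic-resp H c c′ f f (λ u v → same _ _) mono)

  -- The Gallai-Ramsey number is a minimum found by search, for which the property must be
  -- decidable. A colouring is coded as a function on `Fin (n * n)`, the pairs of vertices.
  GallaiRamseyProperty? : Decidable (GallaiRamseyProperty k G H)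
  GallaiRamseyProperty? n = map′ to from (all-functions? Good-resp good?)
    where
    decode : (Fin (n * n) → Fin k) → Fin n → Fin n → Fin k
    decode g u v = g (Fin.combine u v)

    encode : (Fin n → Fin n → Fin k) → Fin (n * n) → Fin k
    encode col z = col (proj₁ (Fin.remQuot {n} n z)) (proj₂ (Fin.remQuot {n} n z))

    decode-encode : ∀ col u v → decode (encode col) u v ≡ col u v
    decode-encode col u v = cong (λ (x , y) → col x y) (Finₚ.remQuot-combine {n} u v)

    Sym : (Fin (n * n) → Fin k) → Set
    Sym g = ∀ u v → decode g u v ≡ decode g v u

    colouring : ∀ g → Sym g → EdgeColouring k n
    colouring g g-sym = record { colour = decode g ; colour-sym = g-sym }

    -- A `g` that is not symmetric codes no colouring and is good vacuously, so all functions can be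
    -- searched.
    Good : (Fin (n * n) → Fin k) → Set
    Good g = (g-sym : Sym g) → Outcome (colouring g g-sym)

    Good-resp : ∀ {g h} → g ≗ h → Good g → Good h
    Good-resp {g} {h} g≗h good h-sym = Outcome-resp (colouring g g-sym) (colouring h h-sym) (λ _ _ → g≗h _) (good g-sym)
      where
      g-sym : Sym g
      g-sym u v = trans (g≗h _) (trans (h-sym u v) (sym (g≗h _)))

    good? : Decidable Good
    good? g with Finₚ.all? (λ u → Finₚ.all? λ v → decode g u v Finₚ.≟ decode g v u)
    ... | no ¬sym = yes λ g-sym → contradiction g-sym ¬sym
    ... | yes g-sym with Outcome? (colouring g g-sym)
    ...   | yes o = yes λ g-sym′ → Outcome-resp (colouring g g-sym) (colouring g g-sym′) (λ _ _ → refl) o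
    ...   | no ¬o = no λ good → ¬o (good g-sym)

    to : (∀ g → Good g) → GallaiRamseyProperty k G H n
    to good c = Outcome-resp (colouring (encode colour) g-sym) c (decode-encode colour) (good (encode colour) g-sym)
      where
      open EdgeColouring c
      g-sym : Sym (encode colour)
      g-sym u v = trans (decode-encode colour u v) (trans (colour-sym u v) (sym (decode-encode colour v u)))

    from : GallaiRamseyProperty k G H n → ∀ g → Good g
    from property g g-sym = property (colouring g g-sym)

-- Upward search from 0, shifting the predicate after each failure; the known witness `n` ends it.
least : {P : Pred ℕ 0ℓ} → Decidable P → ∀ {n} → P n → ∃ λ m → (P m × (∀ l → P l → m ≤ l)) × m ≤ n
least P? {n} p with P? 0
... | yes p₀ = 0 , (p₀ , λ _ _ → z≤n) , z≤n
least P? {zero}  p | no ¬p₀ = contradiction p ¬p₀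
least P? {suc n} p | no ¬p₀ with m , (pm , minimal) , m≤n ← least (P? ∘ suc) p =
  suc m , (pm , λ { zero p₀ → contradiction p₀ ¬p₀ ; (suc l) pl → s≤s (minimal l pl) }) , s≤s m≤n

-- Bounds on size and order, and the final estimate

Peeling-mono : ∀ {G q p xs} → q ≤ p → Peeling G q xs → Peeling G p xs
Peeling-mono q≤p (core xs! short)                 = core xs! (≤-trans short q≤p)
Peeling-mono q≤p (pendant x∉xs one-neighbour peel) = pendant x∉xs one-neighbour (Peeling-mono q≤p peel)

^-distribʳ-* : ∀ o m n → (m * n) ^ o ≡ m ^ o * n ^ o
^-distribʳ-* zero    m n = refl
^-distribʳ-* (suc o) m n = trans (cong (m * n *_) (^-distribʳ-* o m n)) (*-interchange m n (m ^ o) (n ^ o))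

nC2≤n² : ∀ n → n C 2 ≤ n * n
nC2≤n² zero    = z≤n
nC2≤n² (suc n) = begin
  suc n C 2     ≡⟨ nCk+nC[k+1]≡[n+1]C[k+1] n 1 ⟨
  n C 1 + n C 2 ≡⟨ cong (_+ n C 2) (nC1≡n n) ⟩
  n + n C 2     ≤⟨ +-mono-≤ (n≤1+n n) (≤-trans (nC2≤n² n) (*-monoʳ-≤ n (n≤1+n n))) ⟩
  suc n * suc n ∎
  where open ≤-Reasoning

m≤m^suc : ∀ m n → m ≤ m ^ suc n
m≤m^suc zero      n = z≤n
m≤m^suc m@(suc _) n = ≤-trans (≤-reflexive (sym (*-identityʳ m))) (*-monoʳ-≤ m (m^n>0 m n))

module _ {r q e : ℕ} {G : Graph} (peelable : Peelable q e G) (r≡ : Graph.size G ∸ e ≡ r) where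
  open Graph G
  open Peelable peelable

  private
    p M : ℕ
    p = order ∸ r
    M = 2 * p ^ 3

  -- By `sparse`, at least `r` vertices lie outside the core. The inequality can be strict: a
  -- component K₂ loses two vertices but one edge.
  core≤order∸deleted : q ≤ p
  core≤order∸deleted = m+n≤o⇒m≤o∸n q (subst (λ r → q + r ≤ order) r≡ q+deleted≤order)
    where
    open ≤-Reasoning
    q+deleted≤order : q + (size ∸ e) ≤ order
    q+deleted≤order with ≤-total e size
    ... | inj₁ e≤size = +-cancelˡ-≤ e _ _ (begin
      e + (q + (size ∸ e)) ≡⟨ x∙yz≈xz∙y e q (size ∸ e) ⟩
      e + (size ∸ e) + q   ≡⟨ cong (_+ q) (m+[n∸m]≡n e≤size) ⟩
      size + q             ≤⟨ sparse ⟩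
      e + order            ∎)
    ... | inj₂ size≤e = begin
      q + (size ∸ e) ≡⟨ cong (q +_) (m≤n⇒m∸n≡0 size≤e) ⟩
      q + 0          ≡⟨ +-identityʳ q ⟩
      q              ≤⟨ core≤order ⟩
      order          ∎

  module _ (e≤qC2 : e ≤ q C 2) (r≤ : r ≤ M ∸ (p C 2)) where
    open ≤-Reasoning

    private
      p≤M : p ≤ M
      p≤M = ≤-trans (m≤m^suc p 2) (m≤m+n (p ^ 3) _)

      -- Makes the truncated subtraction in the bound on `r` exact.
      pC2≤M : p C 2 ≤ M
      pC2≤M = begin
        p C 2   ≤⟨ nC2≤n² p ⟩
        p * p   ≤⟨ *-monoʳ-≤ p (m≤m^suc p 1) ⟩
        p ^ 3   ≤⟨ m≤m+n (p ^ 3) _ ⟩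
        M       ∎

    -- The final graph has at most C(q,2) ≤ C(p,2) edges, and the bound on `r` is what then remains
    -- up to `M`.
    size-bound : size ≤ M
    size-bound = begin
      size                    ≤⟨ m≤n+m∸n size e ⟩
      e + (size ∸ e)          ≡⟨ cong (e +_) r≡ ⟩
      e + r                   ≤⟨ +-mono-≤ (≤-trans e≤qC2 (nC2-mono core≤order∸deleted)) r≤ ⟩
      p C 2 + (M ∸ (p C 2))   ≡⟨ m+[n∸m]≡n pC2≤M ⟩
      M                       ∎

    order-bound : order ≤ 2 * M
    order-bound = begin
      order     ≤⟨ m≤n+m∸n order r ⟩
      r + p     ≤⟨ +-mono-≤ (≤-trans r≤ (m∸n≤m M (p C 2))) p≤M ⟩
      M + M     ≡⟨ cong (M +_) (+-identityʳ M) ⟨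
      2 * M     ∎

    gallai-ramsey-bound : ∀ {k t} → 1 ≤ k → 1 ≤ t →
      ∃ λ n → GallaiRamseyProperty k G (K t) n × n ≤ 2 ^ (k * t) * p ^ (3 * k * t)
    gallai-ramsey-bound {k} {suc t} k>0 (s≤s _) with p ≤? 0
    -- Here M = 0, so `order-bound` leaves no vertices and the empty map is a rainbow copy.
    -- Otherwise p ≥ 1 gives the 2 ≤ M that the recursion requires.
    ... | yes p≤0 = 0 , (λ c → inj₁ (mk↣ {to = ⊥-elim ∘ no-vertex} (λ {u} → ⊥-elim (no-vertex u)) ,
                                     λ {u} → ⊥-elim (no-vertex u))) , z≤n
      where
      no-vertex : ¬ Vertex
      no-vertex v = n≮0 (≤-trans (Finₚ.toℕ<n v)
        (≤-trans order-bound (≤-reflexive (cong (λ p → 2 * (2 * p ^ 3)) (n≤0⇒n≡0 p≤0)))))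
    ... | no p≰0 = M ^ (k * suc t) ,
      (λ c → rainbow-or-mono c (Peeling-mono core≤order∸deleted peeling) exhaustive 2≤M size-bound t k>0 order-bound ≤-refl) ,
      ≤-reflexive (M^≡ (suc t))
      where
      2≤M : 2 ≤ M
      2≤M = *-monoʳ-≤ 2 (≤-trans (≰⇒> p≰0) (m≤m^suc p 2))

      M^≡ : ∀ t → M ^ (k * t) ≡ 2 ^ (k * t) * p ^ (3 * k * t)
      M^≡ t = begin-equality
        (2 * p ^ 3) ^ (k * t)           ≡⟨ ^-distribʳ-* (k * t) 2 (p ^ 3) ⟩
        2 ^ (k * t) * (p ^ 3) ^ (k * t) ≡⟨ cong (2 ^ (k * t) *_) (^-*-assoc p 3 (k * t)) ⟩
        2 ^ (k * t) * p ^ (3 * (k * t)) ≡⟨ cong (λ e → 2 ^ (k * t) * p ^ e) (*-assoc 3 k t) ⟨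
        2 ^ (k * t) * p ^ (3 * k * t)   ∎

theorem1p9 : (r s t k : ℕ) →
    r ≤ 2 * (s ∸ r) ^ 3 ∸ ((s ∸ r) C 2) → 47 ≤ t → 1 ≤ k →
    (a : ℕ) → 1 ≤ a → (G : ℕ → Graph) → Graph.order (G 1) ≡ s →
    (∀ i → 1 ≤ i → i < a → LeafDeletion (G i) (G (suc i))) →
    Graph.Complete (G a) →
    Graph.size (G 1) ∸ Graph.size (G a) ≡ r →
    ∃ λ n → IsGallaiRamseyNumber k (G 1) (K t) n × n ≤ 2 ^ (k * t) * (s ∸ r) ^ (3 * k * t)
theorem1p9 r s t k r≤ 47≤t 1≤k a 1≤a G refl del complete r≡ =
  let N , property , N≤bound = gallai-ramsey-bound
        (Peelable-chain G a del (a ∸ 1) 1 ≤-refl (m∸n+n≡m 1≤a)) r≡ (size≤orderC2 (G a)) r≤ 1≤k (≤-trans (s≤s z≤n) 47≤t)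
      -- The number `N` within the bound caps the search for the minimum.
      n , isNumber , n≤N = least (GallaiRamseyProperty? k (G 1) (K t)) property
  in  n , isNumber , ≤-trans n≤N N≤bound
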